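{- $\min\{\mathfrak{b},\mathrm{non}(\mathcal{E}^*)\}\leq\mathrm{non}(\langle\mathcal{E},\mathcal{M}\rangle)\leq\mathrm{non}(\mathcal{E}^*)$.
   Context: $2^\omega$ is the Cantor space with coordinatewise addition modulo 2; $\mathcal{M}$ is the $\sigma$-ideal of meager subsets of $2^\omega$ and $\mathcal{E}$ is the $\sigma$-ideal on $2^\omega$ generated by closed Lebesgue measure zero sets. $X+E=\{x+e:x\in X,e\in E\}$. $\langle\mathcal{E},\mathcal{M}\rangle=\{X\subseteq2^\omega:\forall E\in\mathcal{E}\ X+E\in\mathcal{M}\}$ and $\mathcal{E}^*=\{X\subseteq 2^\omega:\forall E\in\mathcal{E}\ X+E\neq 2^\omega\}$. For a class $\mathcal{X}$ of subsets of $2^\omega$, $\mathrm{non}(\mathcal{X})=\min\{|Y|:Y\subseteq2^\omega,\ Y\notin\mathcal{X}\}$. $\mathfrak{b}$ is the bounding number (least size of an unbounded family in $(\omega^\omega,\leq^*)$). -}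

module Defs where

open import Data.Bool.Base using (Bool; _xor_)
open import Data.List.Base using (List; length; applyUpTo; foldr)
open import Data.Nat.Base as ℕ using (ℕ)
open import Data.Product.Base using (∃; ∃₂; _×_; proj₁)
open import Data.Rational.Base using (ℚ; 0ℚ; 1ℚ; ½; _+_; _*_; _<_; _≤_)
open import Data.Sum.Base using (_⊎_)
open import Function.Bundles using (Injection; Inverse)
open import Level using (Level; 0ℓ; suc; _⊔_)
open import Relation.Binary.Bundles using (Setoid)
import Relation.Binary.Construct.On as On
open import Relation.Binary.PropositionalEquality using (_≡_; _≗_; _→-setoid_)
open import Relation.Nullary.Negation using (¬_)
open import Relation.Unary using (Pred; _∈_; _∉_; _⊆_; _≬_; ∁; ⋃; Universal)

private
  variable
    ℓ : Level
    A : Set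

------------------------------------------------------------------------
-- Cardinals

-- A cardinal is represented by any setoid of that cardinality.  Setoids
-- are needed because points of 2^ω and ω^ω are functions, which are
-- identified when they agree pointwise.

Cardinal : Set₁
Cardinal = Setoid 0ℓ 0ℓ

infix 4 _≤ᶜ_ _≈ᶜ_

_≤ᶜ_ _≈ᶜ_ : Cardinal → Cardinal → Set
κ ≤ᶜ ν = Injection κ ν
κ ≈ᶜ ν = Inverse κ ν

∥_∥ : Pred (ℕ → A) 0ℓ → Cardinal
∥_∥ {A} Y = On.setoid (ℕ →-setoid A) (proj₁ {B = Y})

-- A minimum is determined only up to _≈ᶜ_, so "κ = min 𝒜" is a relation.

IsMin : Pred Cardinal ℓ → Cardinal → Set (suc 0ℓ ⊔ ℓ)
IsMin 𝒜 κ = κ ∈ 𝒜 × (∀ ν → ν ∈ 𝒜 → κ ≤ᶜ ν)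

IsMin₂ : Cardinal → Cardinal → Cardinal → Set₁
IsMin₂ κ ν = IsMin (λ μ → μ ≈ᶜ κ ⊎ μ ≈ᶜ ν)

------------------------------------------------------------------------
-- The bounding number

infix 4 _≤*_

_≤*_ : (f g : ℕ → ℕ) → Set
f ≤* g = ∃ λ m → ∀ n → m ℕ.≤ n → f n ℕ.≤ g n

Unbounded : Pred (ℕ → ℕ) 0ℓ → Set
Unbounded F = ¬ (∃ λ g → ∀ f → f ∈ F → f ≤* g)

IsBoundingNumber : Cardinal → Set₁
IsBoundingNumber = IsMin λ κ → ∃ λ F → Unbounded F × κ ≈ᶜ ∥ F ∥

------------------------------------------------------------------------
-- The Cantor space

2^ω : Set
2^ω = ℕ → Bool

Subset : Set₁
Subset = Pred 2^ω 0ℓ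

infixl 6 _⊕_ _⊞_

_⊕_ : 2^ω → 2^ω → 2^ω
(x ⊕ y) n = x n xor y n

_⊞_ : Subset → Subset → Subset
(X ⊞ E) z = ∃₂ λ x e → x ∈ X × e ∈ E × z ≗ x ⊕ e

-- The basic clopen set of all points with initial segment s.

[_] : List Bool → Subset
[ s ] x = applyUpTo x (length s) ≡ s

Open Closed : Subset → Set
Open U   = ∀ x → x ∈ U → ∃ λ s → x ∈ [ s ] × [ s ] ⊆ U
Closed C = Open (∁ C)

closure : Subset → Subset
closure X x = ∀ s → x ∈ [ s ] → [ s ] ≬ X

NowhereDense : Subset → Set
NowhereDense X = ∀ s → ¬ ([ s ] ⊆ closure X)

Meager : Subset → Set₁
Meager X = ∃ λ (N : ℕ → Subset) → (∀ n → NowhereDense (N n)) × X ⊆ ⋃ ℕ N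

-- The Lebesgue measure of [ s ], namely 2^(- length s).

μ[_] : List Bool → ℚ
μ[ s ] = foldr (λ _ q → ½ * q) 1ℚ s

-- Measure zero means outer measure zero.  A series of nonnegative terms
-- has sum at most ε exactly when all its partial sums are at most ε.

Null : Subset → Set
Null X = ∀ ε → 0ℚ < ε → ∃ λ (s : ℕ → List Bool) →
  X ⊆ ⋃ ℕ (λ i → [ s i ]) ×
  (∀ n → foldr _+_ 0ℚ (applyUpTo (λ i → μ[ s i ]) n) ≤ ε)

-- The σ-ideal generated by the closed measure zero sets.

data 𝓔 : Pred Subset (suc 0ℓ) where
  closed-null : ∀ {C} → Closed C → Null C → 𝓔 C
  subset      : ∀ {X Y} → X ⊆ Y → 𝓔 Y → 𝓔 X
  union       : ∀ {X : ℕ → Subset} → (∀ n → 𝓔 (X n)) → 𝓔 (⋃ ℕ X)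

------------------------------------------------------------------------
-- Classes of subsets of 2^ω and their uniformity numbers

⟨_,_⟩ : (𝒥 𝒦 : Pred Subset (suc 0ℓ)) → Pred Subset (suc 0ℓ)
⟨ 𝒥 , 𝒦 ⟩ X = ∀ E → E ∈ 𝒥 → X ⊞ E ∈ 𝒦

infix 8 _⋆

_⋆ : Pred Subset (suc 0ℓ) → Pred Subset (suc 0ℓ)
(𝒥 ⋆) X = ∀ E → E ∈ 𝒥 → ¬ Universal (X ⊞ E)

IsNon : Pred Subset (suc 0ℓ) → Cardinal → Set₁
IsNon 𝒳 = IsMin λ κ → ∃ λ Y → Y ∉ 𝒳 × κ ≈ᶜ ∥ Y ∥

{-# OPTIONS --safe #-}

-- Upper bound: by the Baire category theorem ⟨ 𝓔 , Meager ⟩ ⊆ 𝓔 ⋆.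
--
-- Lower bound: let |Y| < 𝔟 and Y ∈ 𝓔 ⋆, and cover E ∈ 𝓔 by closed null sets
-- C i.  The set of all finite modifications of points of ⋃ C is still in 𝓔,
-- so some z lies outside its sum with Y.  For y ∈ Y and every n, finitely many
-- applications of the openness of ∁ (C i) give an m such that no point of
-- y + C i agrees with z on [n, m).  As |Y| < 𝔟, one function g bounds these m
-- for all y ∈ Y and almost all n.  Hence every point of Y + C i disagrees with
-- z somewhere on [n, g n) for almost all n, and such points form a meager set.

module Submission where

open import Defs
open import Axiom.DoubleNegationElimination using (em⇒dne)
open import Axiom.ExcludedMiddle using (ExcludedMiddle)
open import Data.Bool.Base using (Bool; true; false; not; _xor_)
open import Data.Bool.Properties using (xor-assoc; xor-same; ¬-not)
import Data.Bool.Properties as Bool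
open import Data.List.Base using (List; []; _∷_; length; applyUpTo; foldr)
open import Data.List.Properties using (length-applyUpTo; ∷-injective)
open import Data.Nat.Base using (ℕ; zero; suc; _+_; _⊔_; _≤_; _<_; z≤n; s≤s; s≤s⁻¹; z<s)
open import Data.Nat.Properties
open import Data.Product.Base using (∃; _×_; _,_; proj₁; proj₂)
open import Data.Rational.Base as ℚ using (0ℚ; ½)
open import Data.Sum.Base using (_⊎_; inj₁; inj₂)
open import Function.Base using (_∘_; id)
import Function.Construct.Composition as Composition
import Function.Construct.Identity as Identity
open import Function.Properties.Inverse using (Inverse⇒Injection)
import Function.Construct.Symmetry as Symmetry
open import Level using (0ℓ; Lift; lift; lower) renaming (suc to lsuc)
open import Relation.Binary.PropositionalEquality using (_≡_; _≢_; _≗_; refl; sym; trans; cong; cong₂; subst)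
open import Relation.Nullary.Decidable using (yes; no; map′; does; dec-true; dec-false)
open import Relation.Nullary.Negation using (¬_; contradiction)
open import Relation.Unary using (Pred; _∈_; _∉_; _⊆_; ⋃; Universal)

private
  variable
    A : Set
    x y z w : 2^ω
    S : Pred ℕ 0ℓ
    X Y C : Subset

  -- Enumeration of pairs along antidiagonals

  next : ℕ × ℕ → ℕ × ℕ
  next (zero  , b) = suc b , zero
  next (suc a , b) = a , suc b

unpair : ℕ → ℕ × ℕ
unpair zero    = 0 , 0
unpair (suc n) = next (unpair n)

unpair-surjective : ∀ a b → ∃ λ n → unpair n ≡ (a , b)
unpair-surjective a b = go (a + b) a b refl
  where
  go : ∀ s a b → a + b ≡ s → ∃ λ n → unpair n ≡ (a , b)
  -- The predecessor of a pair under `next` lies on the same antidiagonal with smaller b, or ends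
  -- the previous antidiagonal.
  go s       a       (suc b) eq with n , p ← go s (suc a) b (trans (sym (+-suc a b)) eq) = suc n , cong next p
  go s       zero    zero    eq = 0 , refl
  go (suc s) (suc a) zero    eq with n , p ← go s 0 a (trans (sym (+-identityʳ a)) (suc-injective eq)) = suc n , cong next p

⋃-unpair : (P : ℕ → ℕ → Subset) → ⋃ ℕ (λ i → ⋃ ℕ (P i)) ⊆ ⋃ ℕ (λ n → P (proj₁ (unpair n)) (proj₂ (unpair n)))
⋃-unpair P {x} (i , j , p) with n , eq ← unpair-surjective i j =
  n , subst (λ (i , j) → x ∈ P i j) (sym eq) p

-- Agreement on sets of coordinates, and basic clopen sets

AgreeOn : Pred ℕ 0ℓ → 2^ω → 2^ω → Set
AgreeOn S x y = ∀ k → k ∈ S → x k ≡ y k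

[_,_⟩ : ℕ → ℕ → Pred ℕ 0ℓ
[ n , m ⟩ k = n ≤ k × k < m

⊕-cancelˡ : ∀ x y → x ⊕ (x ⊕ y) ≗ y
⊕-cancelˡ x y k = trans (sym (xor-assoc (x k) (x k) (y k))) (cong (_xor y k) (xor-same (x k)))

agree-transpose : ∀ x y → AgreeOn S (x ⊕ y) z → AgreeOn S y (x ⊕ z)
agree-transpose x y a k k∈S =
  trans (sym (⊕-cancelˡ x y k)) (cong (x k xor_) (a k k∈S))

agree-sym : AgreeOn S x y → AgreeOn S y x
agree-sym a k k∈S = sym (a k k∈S)

agree-⊕ : ∀ q → AgreeOn S x y → AgreeOn S (q ⊕ x) (q ⊕ y)
agree-⊕ q a k k∈S = cong (q k xor_) (a k k∈S)

applyUpTo-cong : ∀ {f g : ℕ → A} n → (∀ k → k < n → f k ≡ g k) → applyUpTo f n ≡ applyUpTo g n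
applyUpTo-cong zero    f≡g = refl
applyUpTo-cong (suc n) f≡g =
  cong₂ _∷_ (f≡g 0 z<s) (applyUpTo-cong n (λ k k<n → f≡g (suc k) (s≤s k<n)))

applyUpTo-injective : ∀ {f g : ℕ → A} n → applyUpTo f n ≡ applyUpTo g n → ∀ k → k < n → f k ≡ g k
applyUpTo-injective (suc n) eq zero    _   = proj₁ (∷-injective eq)
applyUpTo-injective (suc n) eq (suc k) k<n =
  applyUpTo-injective n (proj₂ (∷-injective eq)) k (s≤s⁻¹ k<n)

agree⇒∈[] : ∀ s → x ∈ [ s ] → AgreeOn (_< length s) w x → w ∈ [ s ]
agree⇒∈[] s x∈s a = trans (applyUpTo-cong (length s) a) x∈s

∈[applyUpTo]⇒agree : ∀ l → w ∈ [ applyUpTo x l ] → AgreeOn (_< l) w x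
∈[applyUpTo]⇒agree {w} {x} l w∈ = applyUpTo-injective l
  (subst (λ n → applyUpTo w n ≡ applyUpTo x l) (length-applyUpTo x l) w∈)

agree⇒∈[applyUpTo] : ∀ l → AgreeOn (_< l) w x → w ∈ [ applyUpTo x l ]
agree⇒∈[applyUpTo] {w} {x} l a =
  trans (cong (applyUpTo w) (length-applyUpTo x l)) (applyUpTo-cong l a)

-- Overwrites an initial segment of z instead of shifting z, so that later coordinates stay in
-- place.
extend : List Bool → 2^ω → 2^ω
extend []      z         = z
extend (b ∷ s) z zero    = b
extend (b ∷ s) z (suc k) = extend s (z ∘ suc) k

extend-∈[] : ∀ s → extend s z ∈ [ s ]
extend-∈[] []      = refl
extend-∈[] (b ∷ s) = cong (b ∷_) (extend-∈[] s)

extend-beyond : ∀ s → AgreeOn (length s ≤_) (extend s z) z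
extend-beyond []      k       _       = refl
extend-beyond (b ∷ s) (suc k) (s≤s p) = extend-beyond s k p

∁-closed⇒ball : Closed C → ∀ x → x ∉ C → ∃ λ l → ∀ w → AgreeOn (_< l) w x → w ∉ C
∁-closed⇒ball closed x x∉C with s , x∈s , s⊆∁C ← closed x x∉C =
  length s , λ w a → s⊆∁C (agree⇒∈[] s x∈s a)

-- Flipping a coordinate, and closed sets escaped on an interval

δ : ℕ → 2^ω
δ n k = does (n ≟ k)

δ-≢ : ∀ n z → AgreeOn (n ≢_) (δ n ⊕ z) z
δ-≢ n z k n≢k = cong (_xor z k) (dec-false (n ≟ k) n≢k)

-- Only two values are possible at the coordinate n, and adding `δ n` to z exchanges them.
flip-cases : ∀ n → (∀ k → k ∈ S → n ≢ k → x k ≡ z k) →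
             AgreeOn S x z ⊎ AgreeOn S x (δ n ⊕ z)
flip-cases {S} {x} {z} n a with x n Bool.≟ z n
... | yes xn≡zn = inj₁ agree
  where
  agree : AgreeOn S x z
  agree k k∈S with n ≟ k
  ... | yes refl = xn≡zn
  ... | no  n≢k  = a k k∈S n≢k
... | no  xn≢zn = inj₂ agree
  where
  agree : AgreeOn S x (δ n ⊕ z)
  agree k k∈S with n ≟ k
  ... | yes refl = trans (¬-not xn≢zn) (cong (_xor z n) (sym (dec-true (n ≟ n) refl)))
  ... | no  n≢k  = trans (a k k∈S n≢k) (sym (δ-≢ n z k n≢k))

-- Induction on n. At 0, the point `y ⊕ z` lies outside C, and so does a ball around it. At `suc n`,
-- the coordinate n is unconstrained, so the bounds for z and for its flip at n are both needed.
escape-interval : Closed C → ∀ y n z →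
  (∀ e → e ∈ C → ¬ AgreeOn (n ≤_) (y ⊕ e) z) →
  ∃ λ m → ∀ e → e ∈ C → ¬ AgreeOn [ n , m ⟩ (y ⊕ e) z
escape-interval {C} closed y zero z esc = l , λ e e∈C a →
  ball e (λ k k<l → agree-transpose y e a k (z≤n , k<l)) e∈C
  where
  y⊕z∉C : y ⊕ z ∉ C
  y⊕z∉C y⊕z∈C = esc (y ⊕ z) y⊕z∈C (λ k _ → ⊕-cancelˡ y z k)
  l = proj₁ (∁-closed⇒ball closed (y ⊕ z) y⊕z∉C)
  ball = proj₂ (∁-closed⇒ball closed (y ⊕ z) y⊕z∉C)
escape-interval {C} closed y (suc n) z esc = m₀ ⊔ m₁ , escape
  where
  rec₀ = escape-interval closed y n z λ e e∈C a →
    esc e e∈C (λ k n<k → a k (<⇒≤ n<k))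
  rec₁ = escape-interval closed y n (δ n ⊕ z) λ e e∈C a →
    esc e e∈C (λ k n<k → trans (a k (<⇒≤ n<k)) (δ-≢ n z k (<⇒≢ n<k)))
  m₀ = proj₁ rec₀
  m₁ = proj₁ rec₁
  escape : ∀ e → e ∈ C → ¬ AgreeOn [ suc n , m₀ ⊔ m₁ ⟩ (y ⊕ e) z
  escape e e∈C a
    with flip-cases {S = [ n , m₀ ⊔ m₁ ⟩} n
           (λ k (n≤k , k<m) n≢k → a k (≤∧≢⇒< n≤k n≢k , k<m))
  ... | inj₁ b = proj₂ rec₀ e e∈C λ k (n≤k , k<m₀) → b k (n≤k , m≤n⇒m≤n⊔o m₁ k<m₀)
  ... | inj₂ b = proj₂ rec₁ e e∈C λ k (n≤k , k<m₁) → b k (n≤k , m≤n⇒m≤o⊔n m₀ k<m₁)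

-- Translations and closure properties of `𝓔`

-- A preimage serves as the translate because adding q is an involution up to `≗`.
translate : 2^ω → Subset → Subset
translate q X x = q ⊕ x ∈ X

closed-translate : ∀ q → Closed C → Closed (translate q C)
closed-translate q closed x q⊕x∉C with l , ball ← ∁-closed⇒ball closed (q ⊕ x) q⊕x∉C =
  applyUpTo x l , agree⇒∈[applyUpTo] l (λ _ _ → refl) ,
  λ {w} w∈ → ball (q ⊕ w) (agree-⊕ q (∈[applyUpTo]⇒agree l w∈))

translate-list : 2^ω → List Bool → List Bool
translate-list q []      = []
translate-list q (b ∷ s) = (q 0 xor b) ∷ translate-list (q ∘ suc) s

μ-translate-list : ∀ q s → μ[ translate-list q s ] ≡ μ[ s ]
μ-translate-list q []      = refl
μ-translate-list q (b ∷ s) = cong (½ ℚ.*_) (μ-translate-list (q ∘ suc) s)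

∈[translate-list] : ∀ q s → q ⊕ x ∈ [ s ] → x ∈ [ translate-list q s ]
∈[translate-list]         q []      _  = refl
∈[translate-list] {x = x} q (b ∷ s) eq with eq₀ , eqₛ ← ∷-injective eq = cong₂ _∷_
  (trans (sym (⊕-cancelˡ q x 0)) (cong (q 0 xor_) eq₀))
  (∈[translate-list] (q ∘ suc) s eqₛ)

null-translate : ∀ q → Null X → Null (translate q X)
null-translate q null ε 0<ε with s , cover , sums ← null ε 0<ε =
  (λ i → translate-list q (s i)) ,
  (λ x∈ → let i , p = cover x∈ in i , ∈[translate-list] q (s i) p) ,
  λ n → subst (λ qs → foldr ℚ._+_ 0ℚ qs ℚ.≤ ε)
    (applyUpTo-cong n (λ i _ → sym (μ-translate-list q (s i)))) (sums n)

𝓔-translate : ∀ q → 𝓔 X → 𝓔 (translate q X)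
𝓔-translate q (closed-null closed null) =
  closed-null (closed-translate q closed) (null-translate q null)
𝓔-translate q (subset X⊆Y Y∈𝓔) = subset X⊆Y (𝓔-translate q Y∈𝓔)
𝓔-translate q (union X∈𝓔)      = union (λ n → 𝓔-translate q (X∈𝓔 n))

𝓔-∪ : 𝓔 X → 𝓔 Y → 𝓔 (λ x → x ∈ X ⊎ x ∈ Y)
𝓔-∪ {X} {Y} X∈𝓔 Y∈𝓔 = subset
  (λ { (inj₁ x∈X) → 0 , x∈X ; (inj₂ x∈Y) → 1 , x∈Y })
  (union {X = Z} λ { zero → X∈𝓔 ; (suc _) → Y∈𝓔 })
  where
  Z : ℕ → Subset
  Z zero    = X
  Z (suc _) = Y

-- A normal form for members of `𝓔`, so that arguments about one closed set suffice; nested unions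
-- are flattened by `unpair`.
𝓔-hull : 𝓔 X → ∃ λ (C : ℕ → Subset) → (∀ i → Closed (C i)) × (∀ i → Null (C i)) × X ⊆ ⋃ ℕ C
𝓔-hull (closed-null {C} closed null) = (λ _ → C) , (λ _ → closed) , (λ _ → null) , (0 ,_)
𝓔-hull (subset X⊆Y Y∈𝓔) with C , closed , null , Y⊆C ← 𝓔-hull Y∈𝓔 =
  C , closed , null , Y⊆C ∘ X⊆Y
𝓔-hull (union X∈𝓔) =
  (λ n → D (proj₁ (unpair n)) (proj₂ (unpair n))) ,
  (λ n → proj₁ (proj₂ (𝓔-hull (X∈𝓔 (proj₁ (unpair n))))) (proj₂ (unpair n))) ,
  (λ n → proj₁ (proj₂ (proj₂ (𝓔-hull (X∈𝓔 (proj₁ (unpair n)))))) (proj₂ (unpair n))) ,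
  λ (n , x∈Xn) → ⋃-unpair D (n , proj₂ (proj₂ (proj₂ (𝓔-hull (X∈𝓔 n)))) x∈Xn)
  where
  D : ℕ → ℕ → Subset
  D n = proj₁ (𝓔-hull (X∈𝓔 n))

Modifications : ℕ → Subset → Subset
Modifications n X x = ∃ λ e → e ∈ X × AgreeOn (n ≤_) x e

-- Meager sets

meager-⊆ : X ⊆ Y → Meager Y → Meager X
meager-⊆ X⊆Y (N , nwd , Y⊆N) = N , nwd , Y⊆N ∘ X⊆Y

meager-⋃ : {X : ℕ → Subset} → (∀ n → Meager (X n)) → Meager (⋃ ℕ X)
meager-⋃ meager =
  (λ n → N (proj₁ (unpair n)) (proj₂ (unpair n))) ,
  (λ n → proj₁ (proj₂ (meager (proj₁ (unpair n)))) (proj₂ (unpair n))) ,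
  λ (n , x∈Xn) → ⋃-unpair N (n , proj₂ (proj₂ (meager n)) x∈Xn)
  where
  N : ℕ → ℕ → Subset
  N n = proj₁ (meager n)

EventuallyDisagree : (ℕ → ℕ) → 2^ω → Subset
EventuallyDisagree g z x = ∃ λ m → ∀ n → m ≤ n → ¬ AgreeOn [ n , g n ⟩ x z

-- For a fixed threshold m, every `[ s ]` contains `extend s z`, and a small enough ball around that
-- point consists of points agreeing with z on some `[ n , g n ⟩` with `m ≤ n`.
meager-eventuallyDisagree : ∀ g z → Meager (EventuallyDisagree g z)
meager-eventuallyDisagree g z = N , nwd , id
  where
  N : ℕ → Subset
  N m x = ∀ n → m ≤ n → ¬ AgreeOn [ n , g n ⟩ x z

  nwd : ∀ m → NowhereDense (N m)
  nwd m s s⊆N̄ = w∈N n (m≤m⊔n m (length s)) λ k (n≤k , k<gn) →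
    trans (∈[applyUpTo]⇒agree (g n) w∈ k k<gn)
          (extend-beyond s k (≤-trans (m≤n⊔m m (length s)) n≤k))
    where
    n = m ⊔ length s
    p = s⊆N̄ (extend-∈[] {z} s) (applyUpTo (extend s z) (g n))
          (agree⇒∈[applyUpTo] (g n) (λ _ _ → refl))
    w∈ = proj₁ (proj₂ p)
    w∈N = proj₂ (proj₂ p)

-- Parity, least elements and comparison of cardinals

odd : ℕ → Bool
odd zero    = false
odd (suc n) = not (odd n)

IsLeast : Pred ℕ 0ℓ → Pred ℕ 0ℓ
IsLeast P m = m ∈ P × (∀ k → k ∈ P → m ≤ k)

isLeast-unique : ∀ {P Q : Pred ℕ 0ℓ} {m n} → P ⊆ Q → Q ⊆ P → IsLeast P m → IsLeast Q n → m ≡ n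
isLeast-unique P⊆Q Q⊆P (m∈P , m-min) (n∈Q , n-min) =
  ≤-antisym (m-min _ (Q⊆P n∈Q)) (n-min _ (P⊆Q m∈P))

≤ᶜ-trans : ∀ {κ ν ξ} → κ ≤ᶜ ν → ν ≤ᶜ ξ → κ ≤ᶜ ξ
≤ᶜ-trans = Composition.injection

≈ᶜ⇒≥ᶜ : ∀ {κ ν} → κ ≈ᶜ ν → ν ≤ᶜ κ
≈ᶜ⇒≥ᶜ = Inverse⇒Injection ∘ Symmetry.inverse

≈ᶜ-refl : ∀ {κ} → κ ≈ᶜ κ
≈ᶜ-refl {κ} = Identity.inverse κ

module Classical (em : ExcludedMiddle (lsuc 0ℓ)) where

  em₀ : ExcludedMiddle 0ℓ
  em₀ = map′ lower lift (em {Lift (lsuc 0ℓ) _})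

  dne₀ : ∀ {P : Set} → ¬ ¬ P → P
  dne₀ = em⇒dne em₀

  least : ∀ {P : Pred ℕ 0ℓ} m → m ∈ P → ∃ (IsLeast P)
  least {P} m m∈P with em₀ {P 0}
  least     m       m∈P | yes 0∈P = 0 , 0∈P , λ _ _ → z≤n
  least     zero    0∈P | no  0∉P = contradiction 0∈P 0∉P
  least {P} (suc m) m∈P | no  0∉P with n , n∈P , n-min ← least {P ∘ suc} m m∈P =
    suc n , n∈P , λ { zero 0∈P → contradiction 0∈P 0∉P ; (suc k) k∈P → s≤s (n-min k k∈P) }

  -- Finite modifications of sets in `𝓔`

  -- A ball around a point outside C contains every point `≗` to it.
  closed-resp-≗ : Closed C → x ≗ y → y ∈ C → x ∈ C
  closed-resp-≗ {x = x} closed x≗y y∈C = dne₀ λ x∉C →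
    let l , ball = ∁-closed⇒ball closed x x∉C in ball _ (λ k _ → sym (x≗y k)) y∈C

  -- Induction on n: freeing the coordinate n adds only the translate by `δ n`.
  modifications-∈𝓔 : ∀ (C : ℕ → Subset) → (∀ i → Closed (C i)) → (∀ i → Null (C i)) →
                     ∀ n → 𝓔 (Modifications n (⋃ ℕ C))
  modifications-∈𝓔 C closed null zero = subset
    (λ (e , (i , e∈Ci) , a) → i , closed-resp-≗ (closed i) (λ k → a k z≤n) e∈Ci)
    (union (λ i → closed-null (closed i) (null i)))
  modifications-∈𝓔 C closed null (suc n) = subset split
    (𝓔-∪ M∈𝓔 (𝓔-translate (δ n) M∈𝓔))
    where
    M = Modifications n (⋃ ℕ C)
    M∈𝓔 = modifications-∈𝓔 C closed null n
    split : Modifications (suc n) (⋃ ℕ C) ⊆ λ x → x ∈ M ⊎ x ∈ translate (δ n) M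
    split (e , e∈C , a) with flip-cases {S = n ≤_} n (λ k n≤k n≢k → a k (≤∧≢⇒< n≤k n≢k))
    ... | inj₁ b = inj₁ (e , e∈C , b)
    ... | inj₂ b = inj₂ (e , e∈C , agree-sym (agree-transpose (δ n) _ (agree-sym b)))

  -- The Baire category theorem

  -- If no smaller ball missed N, the whole ball given by x and l would lie in the closure of N.
  shrink : ∀ {N} → NowhereDense N → ∀ x l → ∃ λ x′ → ∃ λ l′ →
           l < l′ × AgreeOn (_< l) x′ x × (∀ w → AgreeOn (_< l′) w x′ → w ∉ N)
  shrink {N} nwd x l = dne₀ λ none → nwd (applyUpTo x l) λ {x′} x′∈ t x′∈t → dne₀ λ t∩N=∅ →
    -- `suc l` forces strict growth; `length t` keeps the new ball inside `[ t ]`.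
    none (x′ , suc l ⊔ length t , m≤m⊔n (suc l) (length t) , ∈[applyUpTo]⇒agree l x′∈ ,
      λ w a w∈N → t∩N=∅ (w ,
        agree⇒∈[] t x′∈t (λ k k<t → a k (≤-trans k<t (m≤n⊔m (suc l) (length t)))) , w∈N))

  baire : Meager X → ¬ Universal X
  baire (N , nwd , X⊆N) universal = let n , lim∈N = X⊆N (universal lim) in
    avoids n lim (lim-agree (suc n)) lim∈N
    where
    stage : ℕ → 2^ω × ℕ
    stage zero    = (λ _ → false) , 0
    stage (suc n) = let x′ , l′ , _ = shrink (nwd n) (proj₁ (stage n)) (proj₂ (stage n)) in x′ , l′

    pt : ℕ → 2^ω
    pt = proj₁ ∘ stage

    len : ℕ → ℕ
    len = proj₂ ∘ stage

    len-increasing : ∀ n → len n < len (suc n)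
    len-increasing n = proj₁ (proj₂ (proj₂ (shrink (nwd n) (pt n) (len n))))

    pt-suc : ∀ n → AgreeOn (_< len n) (pt (suc n)) (pt n)
    pt-suc n = proj₁ (proj₂ (proj₂ (proj₂ (shrink (nwd n) (pt n) (len n)))))

    avoids : ∀ n w → AgreeOn (_< len (suc n)) w (pt (suc n)) → w ∉ N n
    avoids n = proj₂ (proj₂ (proj₂ (proj₂ (shrink (nwd n) (pt n) (len n)))))

    n≤len : ∀ n → n ≤ len n
    n≤len zero    = z≤n
    n≤len (suc n) = ≤-<-trans (n≤len n) (len-increasing n)

    len-mono : ∀ d n → len n ≤ len (d + n)
    len-mono zero    n = ≤-refl
    len-mono (suc d) n = ≤-trans (len-mono d n) (<⇒≤ (len-increasing (d + n)))

    pt-agree : ∀ d n → AgreeOn (_< len n) (pt (d + n)) (pt n)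
    pt-agree zero    n k k<l = refl
    pt-agree (suc d) n k k<l =
      trans (pt-suc (d + n) k (<-≤-trans k<l (len-mono d n))) (pt-agree d n k k<l)

    -- By `n≤len`, stage `suc k` has already fixed the coordinate k.
    lim : 2^ω
    lim k = pt (suc k) k

    -- Both stages suc k and n agree at k with the later stage n + suc k.
    lim-agree : ∀ n → AgreeOn (_< len n) lim (pt n)
    lim-agree n k k<l = trans
      (sym (pt-agree n (suc k) k (n≤len (suc k))))
      (trans (cong (λ j → pt j k) (+-comm n (suc k))) (pt-agree (suc k) n k k<l))

  -- Sets Y with `𝔟` not below their cardinality

  -- For ∥ F ∥ ≤ᶜ ∥ Y ∥ the function attached to y must depend on y only up to ≗
  -- and must determine y.  Taking least witnesses gives the former, and recording
  -- y n in the parity of the n-th value gives the latter.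
  bounded : ∀ {𝔟} → IsBoundingNumber 𝔟 → ¬ (𝔟 ≤ᶜ ∥ Y ∥) → (P : 2^ω → ℕ → Pred ℕ 0ℓ) →
    (∀ x y n → x ≗ y → P x n ⊆ P y n) →
    (∀ y n {m m′} → m ≤ m′ → m ∈ P y n → m′ ∈ P y n) →
    (∀ y → y ∈ Y → ∀ n → ∃ (P y n)) →
    ∃ λ g → ∀ y → y ∈ Y → ∃ λ m → ∀ n → m ≤ n → g n ∈ P y n
  bounded {Y} isb 𝔟≰Y P P-resp P-upward P-nonempty =
    -- If `F` were unbounded, then `𝔟 ≤ᶜ ∥ F ∥ ≤ᶜ ∥ Y ∥`.
    let g , g-bounds = dne₀ λ unbounded → 𝔟≰Y (≤ᶜ-trans (proj₂ isb ∥ F ∥ (F , unbounded , ≈ᶜ-refl)) F≤Y)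
    in g , λ y y∈Y →
      let m , f≤g = g-bounds (f y y∈Y) (y , y∈Y , f-least y y∈Y)
      in m , λ n m≤n → P-upward y n (f≤g n m≤n) (proj₂ (proj₁ (f-least y y∈Y n)))
    where
    Q : 2^ω → ℕ → Pred ℕ 0ℓ
    Q y n m = odd m ≡ y n × m ∈ P y n

    Q-resp : ∀ {x y n} → x ≗ y → Q x n ⊆ Q y n
    Q-resp x≗y (odd-m , m∈P) = trans odd-m (x≗y _) , P-resp _ _ _ x≗y m∈P

    Q-nonempty : ∀ y → y ∈ Y → ∀ n → ∃ (Q y n)
    Q-nonempty y y∈Y n with m , m∈P ← P-nonempty y y∈Y n | odd m Bool.≟ y n
    ... | yes eq = m , eq , m∈P
    -- One of m and `suc m` has the required parity, and `P y n` is upward closed.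
    ... | no neq = suc m , sym (¬-not (neq ∘ sym)) , P-upward y n (n≤1+n m) m∈P

    F : Pred (ℕ → ℕ) 0ℓ
    F f = ∃ λ y → y ∈ Y × (∀ n → IsLeast (Q y n) (f n))

    F≤Y : ∥ F ∥ ≤ᶜ ∥ Y ∥
    F≤Y = record
      { to        = λ (f , y , y∈Y , _) → y , y∈Y
      ; cong      = λ { {f , _ , _ , p} {f′ , _ , _ , p′} f≗f′ n →
          trans (sym (proj₁ (proj₁ (p n)))) (trans (cong odd (f≗f′ n)) (proj₁ (proj₁ (p′ n)))) }
      ; injective = λ { {f , _ , _ , p} {f′ , _ , _ , p′} y≗y′ n →
          isLeast-unique (Q-resp y≗y′) (Q-resp (sym ∘ y≗y′)) (p n) (p′ n) }
      }

    f : ∀ y → y ∈ Y → ℕ → ℕ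
    f y y∈Y n = let m , m∈Q = Q-nonempty y y∈Y n in proj₁ (least {Q y n} m m∈Q)

    f-least : ∀ y y∈Y n → IsLeast (Q y n) (f y y∈Y n)
    f-least y y∈Y n = let m , m∈Q = Q-nonempty y y∈Y n in proj₂ (least {Q y n} m m∈Q)

  -- The bounds from `escape-interval` depend on y; a single g from `bounded` replaces them for
  -- almost all n, which puts the sum inside `EventuallyDisagree g z`.
  meager-⊞-closed : ∀ {𝔟} → IsBoundingNumber 𝔟 → ¬ (𝔟 ≤ᶜ ∥ Y ∥) → Closed C →
    (∀ y → y ∈ Y → ∀ n e → e ∈ C → ¬ AgreeOn (n ≤_) (y ⊕ e) z) → Meager (Y ⊞ C)
  meager-⊞-closed {Y} {C} {z} isb 𝔟≰Y closed escape =
    let g , g-bounds = bounded isb 𝔟≰Y P P-resp P-upward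
          (λ y y∈Y n → escape-interval closed y n z (escape y y∈Y n))
    in meager-⊆
      (λ (y , e , y∈Y , e∈C , x≗y⊕e) → let m , p = g-bounds y y∈Y in
        m , λ n m≤n a → p n m≤n e e∈C (λ k k∈ → trans (sym (x≗y⊕e k)) (a k k∈)))
      (meager-eventuallyDisagree g z)
    where
    P : 2^ω → ℕ → Pred ℕ 0ℓ
    P y n m = ∀ e → e ∈ C → ¬ AgreeOn [ n , m ⟩ (y ⊕ e) z

    P-resp : ∀ x y n → x ≗ y → P x n ⊆ P y n
    P-resp x y n x≗y p e e∈C a = p e e∈C λ k k∈ → trans (cong (_xor e k) (x≗y k)) (a k k∈)

    P-upward : ∀ y n {m m′} → m ≤ m′ → m ∈ P y n → m′ ∈ P y n
    P-upward y n m≤m′ p e e∈C a = p e e∈C λ k (n≤k , k<m) → a k (n≤k , ≤-trans k<m m≤m′)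

  𝓔⋆⇒⟨𝓔,𝓜⟩ : ∀ {𝔟} → IsBoundingNumber 𝔟 → ¬ (𝔟 ≤ᶜ ∥ Y ∥) → Y ∈ 𝓔 ⋆ → Y ∈ ⟨ 𝓔 , Meager ⟩
  𝓔⋆⇒⟨𝓔,𝓜⟩ {Y} isb 𝔟≰Y Y∈𝓔⋆ E E∈𝓔 with C , closed , null , E⊆C ← 𝓔-hull E∈𝓔 =
    meager-⊆
      (λ (y , e , y∈Y , e∈E , eq) → let i , e∈Ci = E⊆C e∈E in i , y , e , y∈Y , e∈Ci , eq)
      (meager-⋃ λ i → meager-⊞-closed isb 𝔟≰Y (closed i) λ y y∈Y n e e∈Ci a →
        -- Agreement of `y ⊕ e` with `z₀` from n on would make `y ⊕ z₀` a finite modification of e,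
        -- and adding y to it gives back `z₀`.
        z₀∉Y⊞M (y , y ⊕ z₀ , y∈Y , (n , e , (i , e∈Ci) , agree-sym (agree-transpose y e a)) ,
               λ k → sym (⊕-cancelˡ y z₀ k)))
    where
    M : Subset
    M = ⋃ ℕ λ n → Modifications n (⋃ ℕ C)

    missed : ∃ λ z → z ∉ Y ⊞ M
    missed = dne₀ λ none → Y∈𝓔⋆ M (union (modifications-∈𝓔 C closed null))
      λ z → dne₀ λ z∉ → none (z , z∉)

    z₀ = proj₁ missed
    z₀∉Y⊞M = proj₂ missed

  ⟨𝓔,𝓜⟩⊆𝓔⋆ : Y ∈ ⟨ 𝓔 , Meager ⟩ → Y ∈ 𝓔 ⋆
  ⟨𝓔,𝓜⟩⊆𝓔⋆ Y∈ E E∈𝓔 = baire (Y∈ E E∈𝓔)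

-- The two inequalities between the cardinals

proposition4p1 : ExcludedMiddle (lsuc 0ℓ) →
    ∀ (𝔟 non-𝓔⋆ non-⟨𝓔,𝓜⟩ min : Cardinal) →
    IsBoundingNumber 𝔟 →
    IsNon (𝓔 ⋆) non-𝓔⋆ →
    IsNon ⟨ 𝓔 , Meager ⟩ non-⟨𝓔,𝓜⟩ →
    IsMin₂ 𝔟 non-𝓔⋆ min →
    min ≤ᶜ non-⟨𝓔,𝓜⟩ × non-⟨𝓔,𝓜⟩ ≤ᶜ non-𝓔⋆
proposition4p1 em 𝔟 non-𝓔⋆ non-⟨𝓔,𝓜⟩ min isb
  ((X , X∉𝓔⋆ , non-𝓔⋆≈X) , non-𝓔⋆-min)
  ((Y , Y∉⟨𝓔,𝓜⟩ , non-⟨𝓔,𝓜⟩≈Y) , non-⟨𝓔,𝓜⟩-min)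
  (_ , min-lower) =
    ≤ᶜ-trans min≤Y (≈ᶜ⇒≥ᶜ non-⟨𝓔,𝓜⟩≈Y) ,
    non-⟨𝓔,𝓜⟩-min non-𝓔⋆ (X , X∉𝓔⋆ ∘ ⟨𝓔,𝓜⟩⊆𝓔⋆ , non-𝓔⋆≈X)
  where
  open Classical em

  min≤Y : min ≤ᶜ ∥ Y ∥
  -- Unless `𝔟 ≤ᶜ ∥ Y ∥`, the set Y cannot lie in `𝓔 ⋆`, and then `non-𝓔⋆ ≤ᶜ ∥ Y ∥`.
  min≤Y with em₀ {𝔟 ≤ᶜ ∥ Y ∥}
  ... | yes 𝔟≤Y = ≤ᶜ-trans (min-lower 𝔟 (inj₁ ≈ᶜ-refl)) 𝔟≤Y
  ... | no  𝔟≰Y = ≤ᶜ-trans (min-lower non-𝓔⋆ (inj₂ ≈ᶜ-refl))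
    (non-𝓔⋆-min ∥ Y ∥ (Y , Y∉⟨𝓔,𝓜⟩ ∘ 𝓔⋆⇒⟨𝓔,𝓜⟩ isb 𝔟≰Y , ≈ᶜ-refl))
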